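{- Let $n$ be a positive integer. Define $g:T_n\to D_n$ by $g(A,B,C)=r(A,B,C)$ if $(A,B,C)\in R_n$; $g(A,B,C)=s(A,B,C)$ if $(A,B,C)\in U_n$; $g(A,B,C)=t(A,B,C)$ if $(A,B,C)\in V_n\setminus U_n$; and $g(A,B,C)=t(z(A,B,C))$ if $(A,B,C)\in J_n$. Then $g$ is a bijection from $T_n$ onto $D_n$. (In particular $(2n+1)\binom{2n}{n}=\sum_{i+j+k=n}\binom{2i}{i}\binom{2j}{j}\binom{2k}{k}$, the sum over nonnegative integer triples.)
   Context: A lattice path here is a finite (possibly empty) sequence of steps, each an up step $(1,1)$ or a down step $(1,-1)$, drawn as a polygonal line from a given starting lattice point; its lattice points are its starting point and the endpoints of its steps; the height of a point is its vertical coordinate. Concatenation of paths means drawing them successively, each starting at the endpoint of the preceding one, the first starting at $(0,0)$. $T_n$ is the set of ordered triples $(A,B,C)$ of lattice paths such that for some nonnegative integers $i,j,k$ with $i+j+k=n$, $A$ has $i$ up and $i$ down steps, $B$ has $j$ up and $j$ down steps, and $C$ has $k$ up and $k$ down steps; each of $A,B,C$ is regarded as drawn starting (and hence ending) on the horizontal axis, and heights of points of $C$ refer to this drawing. $D_n$ is the set of pairs $(H,X)$ where $H$ is a lattice path with $n$ up and $n$ down steps drawn from $(0,0)$ to $(2n,0)$ and $X$ is one of the $2n+1$ lattice points of $H$. $R_n$: triples in $T_n$ with $C$ empty. $U_n$: triples with $C$ having a point strictly above the horizontal axis and $B$ either empty or ending with a down step. $V_n$: triples with $C$ having a point strictly below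 the horizontal axis and $B$ either empty or ending with an up step. $I_n=U_n\cap V_n$. $J_n=T_n\setminus(R_n\cup U_n\cup V_n)$. $r:R_n\to D_n$: $r(A,B,\emptyset)=(H,X)$ with $H$ the concatenation of $A$ and $B$ and $X$ the point where $A$ and $B$ meet. $s:U_n\to D_n$: let $K$ be the leftmost point of $C$ of maximal height, cutting $C$ into left part $C_1$ and right part $C_2$; $s(A,B,C)=(H,X)$ with $H$ the concatenation of $C_1,A,B,C_2$ and $X$ the point where $A$ ends and $B$ begins. $t:V_n\to D_n$: same as $s$ but with $K$ the leftmost point of $C$ of minimal height. $z:J_n\to I_n$: $z(A,B,C)=(A,\emptyset,BC)$, where $BC$ is the concatenation of $B$ followed by $C$. -}

module Defs where

open import Data.Fin as Fin using (Fin; zero; suc; toℕ)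
open import Data.Fin.Properties using (any?)
open import Data.Integer as ℤ using (ℤ; 0ℤ; 1ℤ; -1ℤ; -_)
import Data.Integer.Properties as ℤ
open import Data.List using
  (List; []; _∷_; [_]; _++_; _∷ʳ_; length; filter; take; drop; upTo;
   cartesianProduct; initLast; _∷ʳ′_)
open import Data.List.Properties using
  (length-++; filter-++; take++drop≡id; ++-assoc; ∷ʳ-injectiveʳ)
open import Data.Nat as ℕ using (ℕ; suc; _+_)
import Data.Nat.Properties as ℕ
open import Data.Nat.Solver using (module +-*-Solver)
open import Data.Product using (Σ; ∃; _×_; _,_; proj₁; proj₂)
open import Data.Sum using (_⊎_; inj₁; inj₂)
open import Function using (_∘_)
open import Relation.Binary.Definitions using (DecidableEquality)
open import Relation.Binary.PropositionalEquality using
  (_≡_; refl; sym; trans; cong; cong₂; subst; module ≡-Reasoning)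
open import Relation.Nullary using (¬_; Dec; yes; no; contradiction)
open import Relation.Nullary.Decidable using (_×-dec_; _⊎-dec_)

data Step : Set where
  up down : Step

_≟_ : DecidableEquality Step
up   ≟ up   = yes refl
up   ≟ down = no λ ()
down ≟ up   = no λ ()
down ≟ down = yes refl

Path : Set
Path = List Step

count : Step → Path → ℕ
count s P = length (filter (s ≟_) P)

Balanced : ℕ → Path → Set
Balanced n P = count up P ≡ n × count down P ≡ n

-- Point 0 of a path is its starting point; point m is the endpoint of its m-th step.

Point : Path → Set
Point P = Fin (suc (length P))

rise : Step → ℤ
rise up   = 1ℤ
rise down = -1ℤ

-- Height of a point when the path is drawn starting on the horizontal axis.

height : (P : Path) → Point P → ℤ
height P       zero    = 0ℤ
height (s ∷ P) (suc X) = rise s ℤ.+ height P X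

shift : (P : Path) {Q : Path} → Point Q → Point (P ++ Q)
shift []      X = X
shift (s ∷ P) X = suc (shift P X)

-- The point of the concatenation at which P ends and Q begins.

meet : (P Q : Path) → Point (P ++ Q)
meet P Q = shift P {Q} zero

Triple : Set
Triple = Path × Path × Path

T : ℕ → Set
T n = Σ Triple λ (A , B , C) →
      ∃ λ i → ∃ λ j → ∃ λ k →
      i + j + k ≡ n × Balanced i A × Balanced j B × Balanced k C

D : ℕ → Set
D n = Σ Path λ H → Balanced n H × Point H

HasPointAbove HasPointBelow : Path → Set
HasPointAbove P = ∃ λ (X : Point P) → 0ℤ ℤ.< height P X
HasPointBelow P = ∃ λ (X : Point P) → height P X ℤ.< 0ℤ

EmptyOrEndsWith : Step → Path → Set
EmptyOrEndsWith s P = P ≡ [] ⊎ ∃ λ P′ → P ≡ P′ ∷ʳ s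

InR InU InV InI InJ : Triple → Set
InR (A , B , C) = C ≡ []
InU (A , B , C) = HasPointAbove C × EmptyOrEndsWith down B
InV (A , B , C) = HasPointBelow C × EmptyOrEndsWith up B
InI τ = InU τ × InV τ
InJ τ = ¬ (InR τ ⊎ InU τ ⊎ InV τ)

R U V I J : ℕ → Set
R n = Σ (T n) (InR ∘ proj₁)
U n = Σ (T n) (InU ∘ proj₁)
V n = Σ (T n) (InV ∘ proj₁)
I n = Σ (T n) (InI ∘ proj₁)
J n = Σ (T n) (InJ ∘ proj₁)

empty? : (P : Path) → Dec (P ≡ [])
empty? []      = yes refl
empty? (_ ∷ _) = no λ ()

endsWith? : ∀ s P → Dec (∃ λ P′ → P ≡ P′ ∷ʳ s)
endsWith? s P with initLast P
... | []       = no λ { ([] , ()) ; (_ ∷ _ , ()) }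
... | P′ ∷ʳ′ x with s ≟ x
...   | yes refl = yes (P′ , refl)
...   | no  s≢x  = no λ (Q , eq) → s≢x (sym (∷ʳ-injectiveʳ P′ Q eq))

inR? : ∀ τ → Dec (InR τ)
inR? (A , B , C) = empty? C

inU? : ∀ τ → Dec (InU τ)
inU? (A , B , C) =
  any? (λ X → 0ℤ ℤ.<? height C X) ×-dec (empty? B ⊎-dec endsWith? down B)

inV? : ∀ τ → Dec (InV τ)
inV? (A , B , C) =
  any? (λ X → height C X ℤ.<? 0ℤ) ×-dec (empty? B ⊎-dec endsWith? up B)

LeftmostMax LeftmostMin : ∀ {m} → (Fin m → ℤ) → Fin m → Set
LeftmostMax h K = (∀ X → h X ℤ.≤ h K) × (∀ X → X Fin.< K → h X ℤ.< h K)
LeftmostMin h K = (∀ X → h K ℤ.≤ h X) × (∀ X → X Fin.< K → h K ℤ.< h X)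

leftmostMax : ∀ {m} (h : Fin (suc m) → ℤ) → ∃ (LeftmostMax h)
leftmostMax {ℕ.zero} h = zero , (λ { zero → ℤ.≤-refl }) , λ _ ()
leftmostMax {suc m}  h with leftmostMax (h ∘ suc)
... | K , max , left with h zero ℤ.<? h (suc K)
...   | yes h0<hK = suc K
                  , (λ { zero → ℤ.<⇒≤ h0<hK ; (suc X) → max X })
                  , (λ { zero _ → h0<hK ; (suc X) (ℕ.s≤s X<K) → left X X<K })
...   | no  h0≮hK = zero
                  , (λ { zero → ℤ.≤-refl
                       ; (suc X) → ℤ.≤-trans (max X) (ℤ.≮⇒≥ h0≮hK) })
                  , λ _ ()

leftmostMin : ∀ {m} (h : Fin (suc m) → ℤ) → ∃ (LeftmostMin h)
leftmostMin h with leftmostMax (-_ ∘ h)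
... | K , max , left =
  K , (λ X → ℤ.neg-cancel-≤ (max X)) , (λ X X<K → ℤ.neg-cancel-< (left X X<K))

highest lowest : (C : Path) → Point C
highest C = proj₁ (leftmostMax (height C))
lowest  C = proj₁ (leftmostMin (height C))

count-++ : ∀ s P Q → count s (P ++ Q) ≡ count s P + count s Q
count-++ s P Q =
  trans (cong length (filter-++ (s ≟_) P Q)) (length-++ (filter (s ≟_) P))

balanced-++ : ∀ {i j} P Q → Balanced i P → Balanced j Q → Balanced (i + j) (P ++ Q)
balanced-++ P Q (u , d) (u′ , d′) =
  trans (count-++ up P Q) (cong₂ _+_ u u′) ,
  trans (count-++ down P Q) (cong₂ _+_ d d′)

r : ∀ {n} → R n → D n
r (((A , B , .[]) , i , j , k , refl , a , b , (refl , _)) , refl) =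
  A ++ B , subst (λ m → Balanced m (A ++ B)) (sym (ℕ.+-identityʳ (i + j)))
             (balanced-++ A B a b) , meet A B

-- Cut C at K into C₁ and C₂, and insert A and B in between.

insertAt : ∀ {n} (τ : T n) → let (_ , _ , C) = proj₁ τ in Point C → D n
insertAt {n} ((A , B , C) , i , j , k , i+j+k≡n , (a , a′) , (b , b′) , (c , c′)) K =
  (C₁ ++ A) ++ (B ++ C₂) , (total up a b c , total down a′ b′ c′) ,
  meet (C₁ ++ A) (B ++ C₂)
  where
  C₁ = take (toℕ K) C
  C₂ = drop (toℕ K) C

  total : ∀ s → count s A ≡ i → count s B ≡ j → count s C ≡ k →
          count s ((C₁ ++ A) ++ (B ++ C₂)) ≡ n
  total s refl refl refl = begin
    count s ((C₁ ++ A) ++ (B ++ C₂))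
      ≡⟨ count-++ s (C₁ ++ A) (B ++ C₂) ⟩
    count s (C₁ ++ A) + count s (B ++ C₂)
      ≡⟨ cong₂ _+_ (count-++ s C₁ A) (count-++ s B C₂) ⟩
    (count s C₁ + count s A) + (count s B + count s C₂)
      ≡⟨ solve 4 (λ x y z w → (x :+ y) :+ (z :+ w) := y :+ z :+ (x :+ w)) refl
           (count s C₁) (count s A) (count s B) (count s C₂) ⟩
    count s A + count s B + (count s C₁ + count s C₂)
      ≡⟨ cong (count s A + count s B +_)
           (trans (sym (count-++ s C₁ C₂))
                  (cong (count s) (take++drop≡id (toℕ K) C))) ⟩
    count s A + count s B + count s C
      ≡⟨ i+j+k≡n ⟩
    n ∎
    where
    open ≡-Reasoning
    open +-*-Solver

s : ∀ {n} → U n → D n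
s (τ@((A , B , C) , _) , _) = insertAt τ (highest C)

t : ∀ {n} → V n → D n
t (τ@((A , B , C) , _) , _) = insertAt τ (lowest C)

height-shift : ∀ P Q (X : Point Q) →
               height (P ++ Q) (shift P X) ≡ height (P ++ Q) (meet P Q) ℤ.+ height Q X
height-shift []      Q X = sym (ℤ.+-identityˡ (height Q X))
height-shift (s ∷ P) Q X =
  trans (cong (ℤ._+_ (rise s)) (height-shift P Q X))
        (sym (ℤ.+-assoc (rise s) (height (P ++ Q) (meet P Q)) (height Q X)))

height-meet : ∀ P Q → height (P ++ Q) (meet P Q) ≡ count up P ℤ.⊖ count down P
height-meet []         Q = refl
height-meet (up   ∷ P) Q =
  trans (cong (ℤ._+_ 1ℤ) (height-meet P Q))
        (ℤ.distribʳ-⊖-+-pos 1 (count up P) (count down P))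
height-meet (down ∷ P) Q =
  trans (cong (ℤ._+_ -1ℤ) (height-meet P Q))
        (ℤ.distribʳ-⊖-+-neg 0 (count up P) (count down P))

height-shift-balanced : ∀ {j} P Q → Balanced j P → (X : Point Q) →
                        height (P ++ Q) (shift P X) ≡ height Q X
height-shift-balanced {j} P Q (u , d) X = begin
  height (P ++ Q) (shift P X)
    ≡⟨ height-shift P Q X ⟩
  height (P ++ Q) (meet P Q) ℤ.+ height Q X
    ≡⟨ cong (ℤ._+ height Q X) (height-meet P Q) ⟩
  (count up P ℤ.⊖ count down P) ℤ.+ height Q X
    ≡⟨ cong (ℤ._+ height Q X) (cong₂ ℤ._⊖_ u d) ⟩
  (j ℤ.⊖ j) ℤ.+ height Q X
    ≡⟨ cong (ℤ._+ height Q X) (ℤ.n⊖n≡0 j) ⟩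
  0ℤ ℤ.+ height Q X
    ≡⟨ ℤ.+-identityˡ (height Q X) ⟩
  height Q X ∎
  where open ≡-Reasoning

above-++ʳ : ∀ {j} P Q → Balanced j P → HasPointAbove Q → HasPointAbove (P ++ Q)
above-++ʳ P Q bal (X , 0<h) =
  shift P X , subst (0ℤ ℤ.<_) (sym (height-shift-balanced P Q bal X)) 0<h

below-++ʳ : ∀ {j} P Q → Balanced j P → HasPointBelow Q → HasPointBelow (P ++ Q)
below-++ʳ P Q bal (X , h<0) =
  shift P X , subst (ℤ._< 0ℤ) (sym (height-shift-balanced P Q bal X)) h<0

below-∷ʳ-up : ∀ {j} P Q → Balanced j (P ∷ʳ up) → HasPointBelow ((P ∷ʳ up) ++ Q)
below-∷ʳ-up P Q (u , d) =
  subst HasPointBelow (sym (++-assoc P [ up ] Q))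
    (meet P (up ∷ Q) , subst (ℤ._< 0ℤ) (sym (height-meet P (up ∷ Q))) neg)
  where
  fewer : count up P ℕ.< count down P
  fewer = ℕ.≤-reflexive (begin
    suc (count up P)            ≡⟨ ℕ.+-comm 1 (count up P) ⟩
    count up P + 1              ≡⟨ count-++ up P [ up ] ⟨
    count up (P ∷ʳ up)          ≡⟨ trans u (sym d) ⟩
    count down (P ∷ʳ up)        ≡⟨ count-++ down P [ up ] ⟩
    count down P + 0            ≡⟨ ℕ.+-identityʳ _ ⟩
    count down P                ∎)
    where open ≡-Reasoning

  neg : count up P ℤ.⊖ count down P ℤ.< 0ℤ
  neg = subst (count up P ℤ.⊖ count down P ℤ.<_) (ℤ.n⊖n≡0 (count up P))
          (ℤ.⊖-monoʳ->-< (count up P) fewer)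

above-∷ʳ-down : ∀ {j} P Q → Balanced j (P ∷ʳ down) → HasPointAbove ((P ∷ʳ down) ++ Q)
above-∷ʳ-down P Q (u , d) =
  subst HasPointAbove (sym (++-assoc P [ down ] Q))
    (meet P (down ∷ Q) , subst (0ℤ ℤ.<_) (sym (height-meet P (down ∷ Q))) pos)
  where
  fewer : count down P ℕ.< count up P
  fewer = ℕ.≤-reflexive (begin
    suc (count down P)          ≡⟨ ℕ.+-comm 1 (count down P) ⟩
    count down P + 1            ≡⟨ count-++ down P [ down ] ⟨
    count down (P ∷ʳ down)      ≡⟨ trans d (sym u) ⟩
    count up (P ∷ʳ down)        ≡⟨ count-++ up P [ down ] ⟩
    count up P + 0              ≡⟨ ℕ.+-identityʳ _ ⟩
    count up P                  ∎)
    where open ≡-Reasoning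

  pos : 0ℤ ℤ.< count up P ℤ.⊖ count down P
  pos = subst (ℤ._< count up P ℤ.⊖ count down P) (ℤ.n⊖n≡0 (count down P))
          (ℤ.⊖-monoˡ-< (count down P) fewer)

BC-above-below : ∀ {j} A B C → Balanced j B → InJ (A , B , C) →
                 HasPointAbove (B ++ C) × HasPointBelow (B ++ C)
BC-above-below A B []         bal ¬RUV = contradiction (inj₁ refl) ¬RUV
BC-above-below A B C@(up ∷ _) bal ¬RUV with initLast B
... | []         = contradiction (inj₂ (inj₁ ((suc zero , ℤ.+<+ ℕ.z<s) , inj₁ refl))) ¬RUV
... | B′ ∷ʳ′ up   = above-++ʳ (B′ ∷ʳ up) C bal (suc zero , ℤ.+<+ ℕ.z<s) ,
                   below-∷ʳ-up B′ C bal
... | B′ ∷ʳ′ down = contradiction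
                   (inj₂ (inj₁ ((suc zero , ℤ.+<+ ℕ.z<s) , inj₂ (B′ , refl)))) ¬RUV
BC-above-below A B C@(down ∷ _) bal ¬RUV with initLast B
... | []         = contradiction (inj₂ (inj₂ ((suc zero , ℤ.-<+) , inj₁ refl))) ¬RUV
... | B′ ∷ʳ′ up   = contradiction
                   (inj₂ (inj₂ ((suc zero , ℤ.-<+) , inj₂ (B′ , refl)))) ¬RUV
... | B′ ∷ʳ′ down = above-∷ʳ-down B′ C bal ,
                   below-++ʳ (B′ ∷ʳ down) C bal (suc zero , ℤ.-<+)

z : ∀ {n} → J n → I n
z (((A , B , C) , i , j , k , i+j+k≡n , a , b , c) , ¬RUV) =
  ((A , [] , B ++ C) , i , 0 , j + k , i+0+[j+k]≡n
                     , a , (refl , refl) , balanced-++ B C b c) ,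
  (proj₁ BC , inj₁ refl) , (proj₂ BC , inj₁ refl)
  where
  BC = BC-above-below A B C b ¬RUV

  i+0+[j+k]≡n = trans (cong (_+ (j + k)) (ℕ.+-identityʳ i))
                      (trans (sym (ℕ.+-assoc i j k)) i+j+k≡n)

I⊆V : ∀ {n} → I n → V n
I⊆V (τ , _ , v) = τ , v

g : ∀ {n} → T n → D n
g τ with inR? (proj₁ τ) | inU? (proj₁ τ) | inV? (proj₁ τ)
... | yes ρ | _     | _     = r (τ , ρ)
... | no _  | yes υ | _     = s (τ , υ)
... | no _  | no _  | yes ν = t (τ , ν)
... | no ¬ρ | no ¬υ | no ¬ν =
  t (I⊆V (z (τ , λ { (inj₁ ρ) → ¬ρ ρ
                   ; (inj₂ (inj₁ υ)) → ¬υ υ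
                   ; (inj₂ (inj₂ ν)) → ¬ν ν })))

-- Entries of a triple with sum n are at most n, so the search range is exhaustive.

triples : ℕ → List (ℕ × ℕ × ℕ)
triples n = filter (λ (i , j , k) → i + j + k ℕ.≟ n)
              (cartesianProduct range (cartesianProduct range range))
  where range = upTo (suc n)

{-# OPTIONS --safe #-}
module Submission where

-- The point X of (H , X) cuts H into P and Q, and the sign of the height of X tells the branch of g.
-- Height zero is the image of r. At positive height P = C₁A and Q = BC₂, where C₁ ends at the first
-- visit of P to the height of X and B at the last descent of Q to it; this recovers (A , B , C₁C₂),
-- so s is a bijection onto these pairs, and by reflection t is one onto the pairs of negative height.
-- Finally z is a bijection: if d is the last step of D, a path with points on both sides of the axis,
-- then D splits uniquely into a balanced B and a C that stays on one side of the axis, B being cut off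
-- at the last crossing of the axis. So t ∘ z fills the gap t(I) left by t on V \ U.
-- Up and down are treated at once by measuring heights in a direction d : Step.

open import Defs
open import Axiom.UniquenessOfIdentityProofs using (module Decidable⇒UIP)
open import Data.Fin as Fin using (Fin; zero; suc; toℕ)
open import Data.Fin.Permutation using (↔⇒≡)
open import Data.Fin.Properties using (+↔⊎; *↔×; 1↔⊤)
open import Data.Integer as ℤ using (ℤ; 0ℤ; 1ℤ; -1ℤ; -_)
import Data.Integer.Properties as ℤ
open import Algebra.Properties.AbelianGroup ℤ.+-0-abelianGroup using
  (\\-leftDividesʳ; ∙-cancelˡ)
open import Data.List using
  ([]; _∷_; [_]; _++_; _∷ʳ_; length; map; take; drop; upTo; cartesianProduct;
   initLast; _∷ʳ′_)
open import Data.List.Membership.Propositional using (_∈_)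
open import Data.List.Membership.Propositional.Properties using
  (∈-filter⁺; ∈-filter⁻; ∈-cartesianProduct⁺; ∈-upTo⁺)
open import Data.List.Membership.Setoid.Properties using (unique⇒irrelevant)
open import Data.List.Properties using
  (++-assoc; ++-identityʳ; ++-conicalˡ; ++-conicalʳ; length-++; take++drop≡id;
   ∷-injective; ∷ʳ-injectiveʳ)
open import Data.List.Relation.Unary.Any using (here; there)
open import Data.List.Relation.Unary.Unique.Propositional.Properties using
  (filter⁺; cartesianProduct⁺; upTo⁺)
open import Data.Nat as ℕ using (ℕ; NonZero; _+_; _*_)
open import Data.Nat.Combinatorics using (nCn≡1; nCk+nC[k+1]≡[n+1]C[k+1])
open import Data.Nat.ListAction using (sum)
import Data.Nat.Properties as ℕ
open import Data.Product using (Σ; ∃; ∃₂; _×_; _,_; proj₁; proj₂)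
open import Data.Product.Function.Dependent.Propositional using () renaming (congˡ to Σ-congˡ)
open import Data.Product.Function.NonDependent.Propositional using (_×-cong_)
open import Data.Product.Properties using (≡-dec)
open import Data.Sum using (_⊎_; inj₁; inj₂)
open import Data.Sum.Function.Propositional using (_⊎-cong_)
open import Data.Unit using (⊤)
open import Function using (_∘_; _↔_; mk↔ₛ′; mk⤖)
open import Function.Definitions using (Bijective)
open import Function.Properties.Bijection using (⤖⇒↔)
open import Function.Properties.Inverse using (↔-refl; ↔-sym; ↔-trans)
open import Function.Related.TypeIsomorphisms using (Σ-assoc)
open import Relation.Binary.Definitions using (tri<; tri≈; tri>)
open import Relation.Binary.PropositionalEquality using
  (_≡_; _≢_; refl; sym; trans; cong; cong₂; subst; subst₂; setoid; module ≡-Reasoning)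
open import Relation.Nullary using (¬_; yes; no; contradiction)

-- Heights measured in a direction.

+-cancelˡ-≤ : ∀ k {i j} → k ℤ.+ i ℤ.≤ k ℤ.+ j → i ℤ.≤ j
+-cancelˡ-≤ k {i} {j} k+i≤k+j =
  subst₂ ℤ._≤_ (\\-leftDividesʳ k i) (\\-leftDividesʳ k j) (ℤ.+-monoʳ-≤ (- k) k+i≤k+j)

opp : Step → Step
opp up   = down
opp down = up

-- The height at which `P` ends when `d` is taken as upwards; reflection in the axis changes its
-- sign.
net : Step → Path → ℤ
net d P = count d P ℤ.⊖ count (opp d) P

net-++ : ∀ d P Q → net d (P ++ Q) ≡ net d P ℤ.+ net d Q
net-++ d P Q = begin
  count d (P ++ Q) ℤ.⊖ count (opp d) (P ++ Q)
    ≡⟨ cong₂ ℤ._⊖_ (count-++ d P Q) (count-++ (opp d) P Q) ⟩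
  (a + b) ℤ.⊖ (a′ + b′)
    ≡⟨ ℤ.[+m]-[+n]≡m⊖n (a + b) (a′ + b′) ⟨
  (ℤ.+ a ℤ.+ ℤ.+ b) ℤ.- (ℤ.+ a′ ℤ.+ ℤ.+ b′)
    ≡⟨ solve 4 (λ x y x′ y′ → (x :+ y) :- (x′ :+ y′) := (x :- x′) :+ (y :- y′)) refl
         (ℤ.+ a) (ℤ.+ b) (ℤ.+ a′) (ℤ.+ b′) ⟩
  (ℤ.+ a ℤ.- ℤ.+ a′) ℤ.+ (ℤ.+ b ℤ.- ℤ.+ b′)
    ≡⟨ cong₂ ℤ._+_ (ℤ.[+m]-[+n]≡m⊖n a a′) (ℤ.[+m]-[+n]≡m⊖n b b′) ⟩
  net d P ℤ.+ net d Q ∎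
  where
  open ≡-Reasoning
  open import Data.Integer.Solver using (module +-*-Solver)
  open +-*-Solver
  a = count d P
  b = count d Q
  a′ = count (opp d) P
  b′ = count (opp d) Q

+-net-∷ : ∀ d h s P → h ℤ.+ net d (s ∷ P) ≡ h ℤ.+ net d [ s ] ℤ.+ net d P
+-net-∷ d h s P =
  trans (cong (ℤ._+_ h) (net-++ d [ s ] P)) (sym (ℤ.+-assoc h (net d [ s ]) (net d P)))

net-forward : ∀ d P → net d (d ∷ P) ≡ 1ℤ ℤ.+ net d P
net-forward up   P = net-++ up [ up ] P
net-forward down P = net-++ down [ down ] P

net-back : ∀ d P → net d (opp d ∷ P) ≡ -1ℤ ℤ.+ net d P
net-back up   P = net-++ up [ down ] P
net-back down P = net-++ down [ up ] P

net-opp : ∀ d P → net (opp d) P ≡ - net d P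
net-opp up   P = ℤ.⊖-swap (count down P) (count up P)
net-opp down P = ℤ.⊖-swap (count up P) (count down P)

balanced⇒flat : ∀ {k} d P → Balanced k P → net d P ≡ 0ℤ
balanced⇒flat up   P (refl , e) = trans (cong (ℤ._⊖_ (count up P)) e) (ℤ.n⊖n≡0 (count up P))
balanced⇒flat down P (e , refl) = trans (cong (ℤ._⊖_ (count down P)) e) (ℤ.n⊖n≡0 (count down P))

flat⇒balanced : ∀ d P → net d P ≡ 0ℤ → Balanced (count up P) P
flat⇒balanced up P flat = refl , sym (ℤ.+-injective
  (ℤ.i-j≡0⇒i≡j _ _ (trans (ℤ.[+m]-[+n]≡m⊖n (count up P) (count down P)) flat)))
flat⇒balanced down P flat = refl , ℤ.+-injective
  (ℤ.i-j≡0⇒i≡j _ _ (trans (ℤ.[+m]-[+n]≡m⊖n (count down P) (count up P)) flat))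

flat-++ˡ : ∀ d P Q → net d P ≡ 0ℤ → net d (P ++ Q) ≡ net d Q
flat-++ˡ d P Q flat =
  trans (net-++ d P Q) (trans (cong (ℤ._+ net d Q) flat) (ℤ.+-identityˡ _))

flat-++ʳ : ∀ d P Q → net d Q ≡ 0ℤ → net d (P ++ Q) ≡ net d P
flat-++ʳ d P Q flat =
  trans (net-++ d P Q) (trans (cong (ℤ._+_ (net d P)) flat) (ℤ.+-identityʳ _))

-- Points are given as factorisations `E ++ F ≡ P`, with `net d E` as height. The condition `F ≢ []`
-- leaves out the endpoint, so `FirstMax` makes the endpoint the only point of maximal height.
FirstMax NeverAbove : Step → Path → Set
FirstMax   d P = ∀ E F → E ++ F ≡ P → F ≢ [] → net d E ℤ.< net d P
NeverAbove d P = ∀ E F → E ++ F ≡ P → net d E ℤ.≤ 0ℤ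

-- Uniqueness of cuts.

++-compare : ∀ (P : Path) {Q} P′ {Q′} → P ++ Q ≡ P′ ++ Q′ →
             (∃ λ E → P′ ≡ P ++ E × Q ≡ E ++ Q′) ⊎ (∃ λ E → P ≡ P′ ++ E × Q′ ≡ E ++ Q)
++-compare []      P′       eq = inj₁ (P′ , refl , eq)
++-compare (s ∷ P) []       eq = inj₂ (s ∷ P , refl , sym eq)
++-compare (s ∷ P) (s′ ∷ P′) eq with ∷-injective eq
... | refl , eq′ with ++-compare P P′ eq′
...   | inj₁ (E , refl , q) = inj₁ (E , refl , q)
...   | inj₂ (E , refl , q) = inj₂ (E , refl , q)

-- For nonempty `E` the end of `P` comes before the end of `P ++ E`, so it would have to be strictly
-- lower.
firstMax-extension : ∀ d P E → FirstMax d (P ++ E) → net d E ℤ.≤ 0ℤ → E ≡ []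
firstMax-extension d P []      first E≤0 = refl
firstMax-extension d P E@(_ ∷ _) first E≤0 =
  contradiction
    (subst₂ ℤ._≤_ (sym (net-++ d P E)) (ℤ.+-identityʳ _) (ℤ.+-monoʳ-≤ (net d P) E≤0))
    (ℤ.<⇒≱ (first P E refl λ ()))

-- This determines the extremal cut of C. The overlap `E` of two cuts begins a path that never rises
-- above 0 and ends a path that stops at its first maximum, so it is empty.
cut-unique : ∀ d P P′ {Q Q′} → FirstMax d P → FirstMax d P′ → NeverAbove d Q → NeverAbove d Q′ →
             P ++ Q ≡ P′ ++ Q′ → P ≡ P′ × Q ≡ Q′
cut-unique d P P′ first first′ below below′ eq with ++-compare P P′ eq
... | inj₁ (E , refl , refl) with firstMax-extension d P E first′ (below E _ refl)
...   | refl = sym (++-identityʳ P) , refl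
cut-unique d P P′ first first′ below below′ eq | inj₂ (E , refl , refl)
  with firstMax-extension d P′ E first (below′ E _ refl)
... | refl = ++-identityʳ P′ , refl

flat-rest : ∀ d E {Q Q′} → net d Q ≡ 0ℤ → net d Q′ ≡ 0ℤ → Q ≡ E ++ Q′ → net d E ≡ 0ℤ
flat-rest d E {Q′ = Q′} flat flat′ refl = trans (sym (flat-++ʳ d E Q′ flat′)) flat

-- This separates C₁ from A. The overlap of two cuts is what one flat remainder has in excess of the
-- other, so it is flat, and a first maximum cannot be followed by a flat nonempty extension that
-- again ends at a first maximum.
first-unique : ∀ d P P′ {Q Q′} → FirstMax d P → FirstMax d P′ → net d Q ≡ 0ℤ → net d Q′ ≡ 0ℤ →
               P ++ Q ≡ P′ ++ Q′ → P ≡ P′ × Q ≡ Q′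
first-unique d P P′ first first′ flat flat′ eq with ++-compare P P′ eq
... | inj₁ (E , refl , q)
  with firstMax-extension d P E first′ (ℤ.≤-reflexive (flat-rest d E flat flat′ q))
...   | refl = sym (++-identityʳ P) , q
first-unique d P P′ first first′ flat flat′ eq | inj₂ (E , refl , q)
  with firstMax-extension d P′ E first (ℤ.≤-reflexive (flat-rest d E flat′ flat q))
... | refl = ++-identityʳ P′ , sym q

emptyOrEndsWith-last : ∀ {s} P {x} → EmptyOrEndsWith s (P ∷ʳ x) → s ≡ x
emptyOrEndsWith-last P (inj₁ eq)        = contradiction (++-conicalʳ P _ eq) λ ()
emptyOrEndsWith-last P (inj₂ (P′ , eq)) = sym (∷ʳ-injectiveʳ P P′ eq)

-- A nonempty `E` would be flat and end with a step against `d`. The point before that step has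
-- height 1 in `E`, which `NeverAbove` forbids.
last-extension : ∀ d B E Q → net d B ≡ 0ℤ → net d (B ++ E) ≡ 0ℤ → EmptyOrEndsWith (opp d) (B ++ E) →
                 NeverAbove d (E ++ Q) → E ≡ []
last-extension d B E Q flat flat′ ends below with initLast E
... | []       = refl
... | E₀ ∷ʳ′ x with emptyOrEndsWith-last (B ++ E₀)
                      (subst (EmptyOrEndsWith (opp d)) (sym (++-assoc B E₀ [ x ])) ends)
...   | refl = contradiction (below E₀ (opp d ∷ Q) (sym (++-assoc E₀ [ opp d ] Q))) (ℤ.<⇒≱ E₀>0)
  where
  flatE : net d E₀ ℤ.+ -1ℤ ≡ 0ℤ
  flatE = trans (cong (ℤ._+_ (net d E₀)) (sym (net-back d [])))
    (trans (sym (net-++ d E₀ [ opp d ])) (trans (sym (flat-++ˡ d B (E₀ ∷ʳ opp d) flat)) flat′))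
  E₀>0 : 0ℤ ℤ.< net d E₀
  E₀>0 = subst (0ℤ ℤ.<_) (sym (ℤ.i-j≡0⇒i≡j (net d E₀) 1ℤ flatE)) (ℤ.+<+ ℕ.z<s)

-- This separates B from C₂ in the inverse of an insertion, and B from C in the inverse of `z`.
last-unique : ∀ d B B′ {Q Q′} → net d B ≡ 0ℤ → net d B′ ≡ 0ℤ →
              EmptyOrEndsWith (opp d) B → EmptyOrEndsWith (opp d) B′ →
              NeverAbove d Q → NeverAbove d Q′ → B ++ Q ≡ B′ ++ Q′ → B ≡ B′ × Q ≡ Q′
last-unique d B B′ {Q} {Q′} flat flat′ ends ends′ below below′ eq with ++-compare B B′ eq
... | inj₁ (E , refl , refl) with last-extension d B E Q′ flat flat′ ends′ below
...   | refl = sym (++-identityʳ B) , refl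
last-unique d B B′ {Q} {Q′} flat flat′ ends ends′ below below′ eq | inj₂ (E , refl , refl)
  with last-extension d B′ E Q flat′ flat ends below′
... | refl = ++-identityʳ B′ , refl

-- Existence of cuts.

direction : ∀ d s → s ≡ d ⊎ s ≡ opp d
direction up   up   = inj₁ refl
direction up   down = inj₂ refl
direction down up   = inj₂ refl
direction down down = inj₁ refl

firstMax-∷ : ∀ d s P → FirstMax d P → 0ℤ ℤ.< net d (s ∷ P) → FirstMax d (s ∷ P)
firstMax-∷ d s P first pos []      F eq   F≢[] = pos
firstMax-∷ d s P first pos (_ ∷ E) F refl F≢[] =
  subst₂ ℤ._<_ (sym (net-++ d [ s ] E)) (sym (net-++ d [ s ] (E ++ F)))
    (ℤ.+-monoʳ-< (net d [ s ]) (first E F refl F≢[]))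

-- The prefix up to the first visit to height `h`. The induction lets `h` vary: a step towards `d`
-- leaves one less to climb, a step against it one more.
firstMax-exists : ∀ d h P → ℤ.+ h ℤ.≤ net d P →
                  ∃₂ λ C A → C ++ A ≡ P × net d C ≡ ℤ.+ h × FirstMax d C
firstMax-exists d ℕ.zero P h≤P =
  [] , P , refl , refl , λ E F eq F≢[] → contradiction (++-conicalʳ E F eq) F≢[]
firstMax-exists d (ℕ.suc m) []      (ℤ.+≤+ ())
firstMax-exists d (ℕ.suc m) (s ∷ P) h≤P with direction d s
... | inj₁ refl with firstMax-exists d m P
                     (+-cancelˡ-≤ 1ℤ (subst (ℤ.+ ℕ.suc m ℤ.≤_) (net-forward d P) h≤P))
...   | C , A , refl , netC , first =
  d ∷ C , A , refl , net∷ , firstMax-∷ d d C first (subst (0ℤ ℤ.<_) (sym net∷) (ℤ.+<+ ℕ.z<s))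
  where
  net∷ : net d (d ∷ C) ≡ ℤ.+ ℕ.suc m
  net∷ = trans (net-forward d C) (cong (ℤ._+_ 1ℤ) netC)
firstMax-exists d (ℕ.suc m) (s ∷ P) h≤P | inj₂ refl with firstMax-exists d (ℕ.suc (ℕ.suc m)) P
                     (+-cancelˡ-≤ -1ℤ (subst (ℤ.+ ℕ.suc m ℤ.≤_) (net-back d P) h≤P))
...   | C , A , refl , netC , first =
  opp d ∷ C , A , refl , net∷ ,
  firstMax-∷ d (opp d) C first (subst (0ℤ ℤ.<_) (sym net∷) (ℤ.+<+ ℕ.z<s))
  where
  net∷ : net d (opp d ∷ C) ≡ ℤ.+ ℕ.suc m
  net∷ = trans (net-back d C) (cong (ℤ._+_ -1ℤ) netC)

-- Heights are those of Q drawn from height h, so that the induction can move the starting point;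
-- B stops just before the last descent to the axis.

last-descent : ∀ d h Q → h ℤ.+ net d Q ℤ.≤ 0ℤ →
               (∀ E F → E ++ F ≡ Q → h ℤ.+ net d E ℤ.≤ 0ℤ) ⊎
               (∃₂ λ B C → B ++ opp d ∷ C ≡ Q × h ℤ.+ net d B ≡ 1ℤ × NeverAbove d C)
last-descent d h []      h≤0 =
  inj₁ λ E F eq → subst (λ E → h ℤ.+ net d E ℤ.≤ 0ℤ) (sym (++-conicalˡ E F eq)) h≤0
last-descent d h (s ∷ Q) h+Q≤0 with last-descent d (h ℤ.+ net d [ s ]) Q
                                     (subst (ℤ._≤ 0ℤ) (+-net-∷ d h s Q) h+Q≤0)
... | inj₂ (B , C , eq , netB , below) =
  inj₂ (s ∷ B , C , cong (s ∷_) eq , trans (+-net-∷ d h s B) netB , below)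
... | inj₁ below with h ℤ.≤? 0ℤ
...   | yes h≤0 = inj₁ λ
  { []      F eq → subst (ℤ._≤ 0ℤ) (sym (ℤ.+-identityʳ h)) h≤0
  ; (_ ∷ E) F refl → subst (ℤ._≤ 0ℤ) (sym (+-net-∷ d h s E)) (below E F refl) }
...   | no h≰0 with direction d s
-- A step towards `d` would start the remaining path at `h` plus 1, a positive height.
...     | inj₁ refl = contradiction
  (ℤ.≤-trans (ℤ.i≤i+j h 1ℤ) (subst (ℤ._≤ 0ℤ) step (below [] Q refl))) h≰0
  where
  step : h ℤ.+ net d [ d ] ℤ.+ 0ℤ ≡ h ℤ.+ 1ℤ
  step = trans (ℤ.+-identityʳ _) (cong (ℤ._+_ h) (net-forward d []))
-- This step leads from a positive height to a path that never rises above 0 again, so it starts at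
-- height exactly 1 and is the last descent.
...     | inj₂ refl = inj₂ ([] , Q , refl , trans (ℤ.+-identityʳ h) h≡1 , λ E F eq →
  subst (ℤ._≤ 0ℤ) (trans (cong (ℤ._+ net d E) (trans step (cong (ℤ._+ -1ℤ) h≡1))) (ℤ.+-identityˡ _))
    (below E F eq))
  where
  step : h ℤ.+ net d [ opp d ] ≡ h ℤ.+ -1ℤ
  step = cong (ℤ._+_ h) (net-back d [])
  h≡1 : h ≡ 1ℤ
  h≡1 = ℤ.≤-antisym
    (ℤ.i-j≤0⇒i≤j (subst (ℤ._≤ 0ℤ) (trans (ℤ.+-identityʳ _) step) (below [] Q refl)))
    (ℤ.i<j⇒suc[i]≤j (ℤ.≰⇒> h≰0))

-- The last descent itself is put into `B`, which makes `B` flat; if `Q` never rises above 0, then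
-- `B` is empty.
last-exists : ∀ d Q → net d Q ℤ.≤ 0ℤ →
              ∃₂ λ B C → B ++ C ≡ Q × net d B ≡ 0ℤ × EmptyOrEndsWith (opp d) B × NeverAbove d C
last-exists d Q Q≤0 with last-descent d 0ℤ Q (subst (ℤ._≤ 0ℤ) (sym (ℤ.+-identityˡ _)) Q≤0)
... | inj₁ below = [] , Q , refl , refl , inj₁ refl ,
  λ E F eq → subst (ℤ._≤ 0ℤ) (ℤ.+-identityˡ _) (below E F eq)
... | inj₂ (B , C , refl , netB , below) =
  B ∷ʳ opp d , C , ++-assoc B [ opp d ] C ,
  trans (net-++ d B [ opp d ])
    (cong₂ ℤ._+_ (trans (sym (ℤ.+-identityˡ (net d B))) netB) (net-back d [])) ,
  inj₂ (B , refl) , below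

-- Points as cuts, and extremal points.

data Cut : (P : Path) → Point P → Set where
  cut : ∀ P Q → Cut (P ++ Q) (meet P Q)

-- Matching on this view replaces an index into a path by the two parts on either side of it.
cutAt : ∀ P (X : Point P) → Cut P X
cutAt P       zero    = cut [] P
cutAt (s ∷ P) (suc X) with cutAt P X
... | cut P₁ P₂ = cut (s ∷ P₁) P₂

toℕ-meet : ∀ P Q → toℕ (meet P Q) ≡ length P
toℕ-meet []      Q = refl
toℕ-meet (_ ∷ P) Q = cong ℕ.suc (toℕ-meet P Q)

take-meet : ∀ P Q → take (toℕ (meet P Q)) (P ++ Q) ≡ P
take-meet []      Q = refl
take-meet (s ∷ P) Q = cong (s ∷_) (take-meet P Q)

drop-meet : ∀ P Q → drop (toℕ (meet P Q)) (P ++ Q) ≡ Q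
drop-meet []      Q = refl
drop-meet (s ∷ P) Q = drop-meet P Q

elevation : Step → (P : Path) → Point P → ℤ
elevation up   P X = height P X
elevation down P X = - height P X

elevation-meet : ∀ d P Q → elevation d (P ++ Q) (meet P Q) ≡ net d P
elevation-meet up   P Q = height-meet P Q
elevation-meet down P Q = trans (cong -_ (height-meet P Q)) (sym (net-opp up P))

-- Taking the factorisation as an equation yields a point of `P` itself, with no transport along
-- associativity where it is used.
endpoint : ∀ d {P} E F → E ++ F ≡ P →
           ∃ λ (X : Point P) → toℕ X ≡ length E × elevation d P X ≡ net d E
endpoint d E F refl = meet E F , toℕ-meet E F , elevation-meet d E F

leftmostMax⇒cut : ∀ d P K → LeftmostMax (elevation d P) K →
                  FirstMax d (take (toℕ K) P) × NeverAbove d (drop (toℕ K) P)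
leftmostMax⇒cut d P K (max , left) with cutAt P K
... | cut P₁ P₂ rewrite take-meet P₁ P₂ | drop-meet P₁ P₂ = first , below
  where
  first : FirstMax d P₁
  first E []      refl F≢[] = contradiction refl F≢[]
  first E F@(_ ∷ _) refl F≢[] with endpoint d E (F ++ P₂) (sym (++-assoc E F P₂))
  -- Since `F` is nonempty, `X` lies strictly left of the maximum and the strict bound applies.
  ... | X , X≡ , hX = subst₂ ℤ._<_ hX (elevation-meet d P₁ P₂)
    (left X (subst₂ ℕ._<_ (sym X≡) (sym (trans (toℕ-meet P₁ P₂) (length-++ E)))
              (ℕ.m<m+n (length E) ℕ.z<s)))

  below : NeverAbove d P₂
  below E F refl with endpoint d (P₁ ++ E) F (++-assoc P₁ E F)
  -- Cancelling the height of the maximum turns a height in the whole path into a height in `P₂`.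
  ... | X , _ , hX = +-cancelˡ-≤ (net d P₁)
    (subst₂ ℤ._≤_ (trans hX (net-++ d P₁ E))
      (trans (elevation-meet d P₁ P₂) (sym (ℤ.+-identityʳ _))) (max X))

extremum : Step → (P : Path) → Point P
extremum up   = highest
extremum down = lowest

extremum-leftmost : ∀ d P → LeftmostMax (elevation d P) (extremum d P)
extremum-leftmost up   P = proj₂ (leftmostMax (height P))
extremum-leftmost down P with proj₂ (leftmostMin (height P))
... | min , left = (λ X → ℤ.neg-mono-≤ (min X)) , λ X X<K → ℤ.neg-mono-< (left X X<K)

OnSide : Step → Path → Set
OnSide up   = HasPointAbove
OnSide down = HasPointBelow

onSide⁻ : ∀ d P → OnSide d P → ∃₂ λ E F → E ++ F ≡ P × 0ℤ ℤ.< net d E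
onSide⁻ up P (X , pos) with cutAt P X
... | cut E F = E , F , refl , subst (0ℤ ℤ.<_) (height-meet E F) pos
onSide⁻ down P (X , neg) with cutAt P X
... | cut E F = E , F , refl ,
  subst (0ℤ ℤ.<_) (elevation-meet down E F) (ℤ.neg-mono-< neg)

onSide⁺ : ∀ d {P} E F → E ++ F ≡ P → 0ℤ ℤ.< net d E → OnSide d P
onSide⁺ up   E F refl pos = meet E F , subst (0ℤ ℤ.<_) (sym (height-meet E F)) pos
onSide⁺ down E F refl pos = meet E F ,
  ℤ.neg-cancel-< (subst (0ℤ ℤ.<_) (sym (elevation-meet down E F)) pos)

neverAbove⇒¬onSide : ∀ d {P} → NeverAbove d P → ¬ OnSide d P
neverAbove⇒¬onSide d {P} below on with onSide⁻ d P on
... | E , F , eq , pos = ℤ.<⇒≱ pos (below E F eq)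

¬onSide⇒neverAbove : ∀ d {P} → ¬ OnSide d P → NeverAbove d P
¬onSide⇒neverAbove d ¬on E F eq = ℤ.≮⇒≥ λ pos → ¬on (onSide⁺ d E F eq pos)

-- Balancedness without the number of steps. The record wrapper allows `P` to be inferred from a
-- proof.
record Flat (P : Path) : Set where
  constructor flat
  field net≡0 : ∀ d → net d P ≡ 0ℤ

open Flat

mkFlat : ∀ d P → net d P ≡ 0ℤ → Flat P
mkFlat d P eq = flat λ e → balanced⇒flat e P (flat⇒balanced d P eq)

-- Insertion of A and B into C at an extremal point.

FlatTriple : Triple → Set
FlatTriple (A , B , C) = Flat A × Flat B × Flat C

total : Step → Triple → ℕ
total s (A , B , C) = count s A + count s B + count s C

-- The graph of `s` for `up` and of `t` for `down`, with the pointed path given by its parts before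
-- and after the point. The cut of C is characterised rather than computed, and the concatenations
-- stand in equations so that pattern matching need not unify them.
data Insertion (d : Step) : Triple → Path × Path → Set where
  insertion : ∀ {A B C p} C₁ C₂ → C₁ ++ C₂ ≡ C → FirstMax d C₁ → NeverAbove d C₂ →
              0ℤ ℤ.< net d C₁ → EmptyOrEndsWith (opp d) B →
              p ≡ (C₁ ++ A , B ++ C₂) → Insertion d (A , B , C) p

-- The part before the point determines C₁ and A, the part after it B and C₂.
insertion-injective : ∀ {d σ σ′ p} → FlatTriple σ → FlatTriple σ′ →
                      Insertion d σ p → Insertion d σ′ p → σ ≡ σ′
insertion-injective {d} {A , B , _} {A′ , B′ , _} (a , b , _) (a′ , b′ , _)
  (insertion C₁ C₂ refl first below _ ends p≡)
  (insertion C₁′ C₂′ refl first′ below′ _ ends′ p≡′)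
  with first-unique d C₁ C₁′ first first′ (net≡0 a d) (net≡0 a′ d)
         (cong proj₁ (trans (sym p≡) p≡′))
     | last-unique d B B′ (net≡0 b d) (net≡0 b′ d) ends ends′ below below′
         (cong proj₂ (trans (sym p≡) p≡′))
... | refl , refl | refl , refl = refl

insertion-functional : ∀ {d σ p p′} → Insertion d σ p → Insertion d σ p′ → p ≡ p′
insertion-functional {d}
  (insertion C₁ C₂ C₁₂ first below _ _ refl) (insertion C₁′ C₂′ C₁₂′ first′ below′ _ _ refl)
  with cut-unique d C₁ C₁′ first first′ below below′ (trans C₁₂ (sym C₁₂′))
... | refl , refl = refl

-- As A is flat, the marked point has the height of the extremal point of C.
insertion-side : ∀ {d σ p} → FlatTriple σ → Insertion d σ p → 0ℤ ℤ.< net d (proj₁ p)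
insertion-side {d} {A , _} (a , _) (insertion C₁ _ _ _ _ pos _ refl) =
  subst (0ℤ ℤ.<_) (sym (flat-++ʳ d C₁ A (net≡0 a d))) pos

insertion-total : ∀ {d σ P Q} → Insertion d σ (P , Q) → ∀ s → count s (P ++ Q) ≡ total s σ
insertion-total {σ = A , B , _} (insertion C₁ C₂ refl _ _ _ _ refl) s = begin
  count s ((C₁ ++ A) ++ (B ++ C₂))
    ≡⟨ count-++ s (C₁ ++ A) (B ++ C₂) ⟩
  count s (C₁ ++ A) + count s (B ++ C₂)
    ≡⟨ cong₂ _+_ (count-++ s C₁ A) (count-++ s B C₂) ⟩
  (count s C₁ + count s A) + (count s B + count s C₂)
    ≡⟨ solve 4 (λ x y z w → (x :+ y) :+ (z :+ w) := y :+ z :+ (x :+ w)) refl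
         (count s C₁) (count s A) (count s B) (count s C₂) ⟩
  count s A + count s B + (count s C₁ + count s C₂)
    ≡⟨ cong (count s A + count s B +_) (count-++ s C₁ C₂) ⟨
  count s A + count s B + count s (C₁ ++ C₂) ∎
  where
  open ≡-Reasoning
  open import Data.Nat.Solver using (module +-*-Solver)
  open +-*-Solver

-- C₁ ends at the first visit of `P` to its final height `h`, and B at the last descent of `Q` to
-- that level. Then A is flat because C₁ and `P` end at the same height, and C is flat because
-- deleting the flat paths A and B does not change the total.
insertion-exists : ∀ d P Q → 0ℤ ℤ.< net d P → net d (P ++ Q) ≡ 0ℤ →
                   ∃ λ σ → FlatTriple σ × Insertion d σ (P , Q)
insertion-exists d P Q pos P+Q≡0 with net d P in netP
insertion-exists d P Q (ℤ.+<+ {n = h} 0<h) P+Q≡0 | ℤ.+ h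
  with firstMax-exists d h P (ℤ.≤-reflexive (sym netP)) | last-exists d Q Q≤0
  where
  Q≤0 : net d Q ℤ.≤ 0ℤ
  Q≤0 = ℤ.≤-trans (ℤ.i≤j+i (net d Q) (ℤ.+ h)) (ℤ.≤-reflexive
    (trans (cong (ℤ._+ net d Q) (sym netP)) (trans (sym (net-++ d P Q)) P+Q≡0)))
... | C₁ , A , refl , netC₁ , first | B , C₂ , refl , netB , ends , below =
  (A , B , C₁ ++ C₂) , (mkFlat d A flatA , mkFlat d B netB , mkFlat d (C₁ ++ C₂) flatC) ,
  insertion C₁ C₂ refl first below (subst (0ℤ ℤ.<_) (sym netC₁) (ℤ.+<+ 0<h)) ends refl
  where
  flatA : net d A ≡ 0ℤ
  flatA = ∙-cancelˡ (net d C₁) (net d A) 0ℤ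
    (trans (sym (net-++ d C₁ A)) (trans netP (trans (sym netC₁) (sym (ℤ.+-identityʳ (net d C₁))))))
  flatC : net d (C₁ ++ C₂) ≡ 0ℤ
  flatC = begin
    net d (C₁ ++ C₂)                     ≡⟨ net-++ d C₁ C₂ ⟩
    net d C₁ ℤ.+ net d C₂                ≡⟨ cong₂ ℤ._+_ (flat-++ʳ d C₁ A flatA) (flat-++ˡ d B C₂ netB) ⟨
    net d (C₁ ++ A) ℤ.+ net d (B ++ C₂)  ≡⟨ net-++ d (C₁ ++ A) (B ++ C₂) ⟨
    net d ((C₁ ++ A) ++ (B ++ C₂))       ≡⟨ P+Q≡0 ⟩
    0ℤ ∎
    where open ≡-Reasoning

-- For `up` this unfolds to `InU` and for `down` to `InV`, so proofs of one serve as proofs of the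
-- other.
InSide : Step → Triple → Set
InSide d (A , B , C) = OnSide d C × EmptyOrEndsWith (opp d) B

insertion⇒inSide : ∀ {d σ p} → Insertion d σ p → InSide d σ
insertion⇒inSide {d} (insertion C₁ C₂ C₁₂ _ _ pos ends _) = onSide⁺ d C₁ C₂ C₁₂ pos , ends

elevation-take : ∀ d P X → elevation d P X ≡ net d (take (toℕ X) P)
elevation-take d P X with cutAt P X
... | cut P₁ P₂ = trans (elevation-meet d P₁ P₂) (sym (cong (net d) (take-meet P₁ P₂)))

-- The extremal point has positive height towards `d` because it is at least as high as the given
-- point on that side.
inSide⇒insertion : ∀ d {A B C} → InSide d (A , B , C) → let K = extremum d C in
                   Insertion d (A , B , C) (take (toℕ K) C ++ A , B ++ drop (toℕ K) C)
inSide⇒insertion d {C = C} (on , ends) =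
  let K = extremum d C
      leftmost = extremum-leftmost d C
      first , below = leftmostMax⇒cut d C K leftmost
      E , F , E++F≡C , E>0 = onSide⁻ d C on
      X , _ , hX = endpoint d E F E++F≡C
  in insertion (take (toℕ K) C) (drop (toℕ K) C) (take++drop≡id (toℕ K) C) first below
       (ℤ.<-≤-trans E>0 (subst₂ ℤ._≤_ hX (elevation-take d C K) (proj₁ leftmost X))) ends refl

-- The map `z` and its inverse.

-- By flat-last, d is the last step of C, so it can be read off B ++ C.

inJ⇒shape : ∀ {A B C} → InJ (A , B , C) →
            ∃ λ d → (∃ λ B₀ → B ≡ B₀ ∷ʳ opp d) × NeverAbove d C × C ≢ []
inJ⇒shape {A} {B} {C} ¬RUV with initLast B
inJ⇒shape {C = []}       ¬RUV | [] = contradiction (inj₁ refl) ¬RUV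
inJ⇒shape {C = up ∷ C}   ¬RUV | [] =
  contradiction (inj₂ (inj₁ ((suc zero , ℤ.+<+ ℕ.z<s) , inj₁ refl))) ¬RUV
inJ⇒shape {C = down ∷ C} ¬RUV | [] =
  contradiction (inj₂ (inj₂ ((suc zero , ℤ.-<+) , inj₁ refl))) ¬RUV
... | B₀ ∷ʳ′ up   = down , (B₀ , refl) ,
  ¬onSide⇒neverAbove down (λ on → ¬RUV (inj₂ (inj₂ (on , inj₂ (B₀ , refl))))) , ¬RUV ∘ inj₁
... | B₀ ∷ʳ′ down = up , (B₀ , refl) ,
  ¬onSide⇒neverAbove up (λ on → ¬RUV (inj₂ (inj₁ (on , inj₂ (B₀ , refl))))) , ¬RUV ∘ inj₁

-- A last step against `d` would reach height 0 from height 1, where the path never is.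
flat-last : ∀ d {P} → net d P ≡ 0ℤ → NeverAbove d P → P ≢ [] → ∃ λ P₀ → P ≡ P₀ ∷ʳ d
flat-last d {P} flatP below P≢[] with initLast P
... | [] = contradiction refl P≢[]
... | P₀ ∷ʳ′ x with direction d x
...   | inj₁ refl = P₀ , refl
...   | inj₂ refl = contradiction
  (last-extension d [] (P₀ ∷ʳ opp d) [] refl flatP (inj₂ (P₀ , refl))
    (subst (NeverAbove d) (sym (++-identityʳ _)) below)) P≢[]

join-injective : ∀ {A B C A′ B′ C′} → FlatTriple (A , B , C) → FlatTriple (A′ , B′ , C′) →
                 InJ (A , B , C) → InJ (A′ , B′ , C′) → B ++ C ≡ B′ ++ C′ → B ≡ B′ × C ≡ C′
join-injective {A} {B} {A′ = A′} {B′ = B′} (_ , b , c) (_ , b′ , c′) J J′ eq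
  with inJ⇒shape {A} {B} J | inJ⇒shape {A′} {B′} J′
... | d , ends , below , C≢[] | d′ , ends′ , below′ , C′≢[]
  with flat-last d (net≡0 c d) below C≢[] | flat-last d′ (net≡0 c′ d′) below′ C′≢[]
... | C₀ , refl | C₀′ , refl
  -- Both directions are the last step of the common concatenation, so they agree and the cuts can
  -- be compared.
  with ∷ʳ-injectiveʳ (B ++ C₀) (B′ ++ C₀′)
         (trans (++-assoc B C₀ [ d ]) (trans eq (sym (++-assoc B′ C₀′ [ d′ ]))))
... | refl = last-unique d B B′ (net≡0 b d) (net≡0 b′ d) (inj₂ ends) (inj₂ ends′) below below′ eq

-- On the intersection of U and V this makes B empty, which is the shape of the values of `z`.
ends-both : ∀ d {P} → EmptyOrEndsWith d P → EmptyOrEndsWith (opp d) P → P ≡ []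
ends-both d    (inj₁ P≡[])      _    = P≡[]
ends-both up   (inj₂ (P , refl)) ends = contradiction (emptyOrEndsWith-last P ends) λ ()
ends-both down (inj₂ (P , refl)) ends = contradiction (emptyOrEndsWith-last P ends) λ ()

inJ⁺ : ∀ d {τ} → ¬ InR τ → ¬ InSide d τ → ¬ InSide (opp d) τ → InJ τ
inJ⁺ up   ¬R ¬U ¬V (inj₁ ρ)        = ¬R ρ
inJ⁺ up   ¬R ¬U ¬V (inj₂ (inj₁ υ)) = ¬U υ
inJ⁺ up   ¬R ¬U ¬V (inj₂ (inj₂ ν)) = ¬V ν
inJ⁺ down ¬R ¬V ¬U (inj₁ ρ)        = ¬R ρ
inJ⁺ down ¬R ¬V ¬U (inj₂ (inj₁ υ)) = ¬U υ
inJ⁺ down ¬R ¬V ¬U (inj₂ (inj₂ ν)) = ¬V ν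

onBothSides : ∀ d {P} → HasPointAbove P → HasPointBelow P → OnSide d P
onBothSides up   above below = above
onBothSides down above below = below

join-surjective : ∀ A {D} → Flat D → HasPointAbove D → HasPointBelow D →
                  ∃₂ λ B C → B ++ C ≡ D × Flat B × Flat C × InJ (A , B , C)
join-surjective A {D} flatD above below with initLast D
... | [] = contradiction above λ { (zero , ℤ.+<+ ()) }
... | D₀ ∷ʳ′ d with last-exists d (D₀ ∷ʳ d) (ℤ.≤-reflexive (net≡0 flatD d))
...   | B , C , eq , flatB , ends , never =
  B , C , eq , mkFlat d B flatB ,
  mkFlat d C (trans (sym (flat-++ˡ d B C flatB)) (trans (cong (net d) eq) (net≡0 flatD d))) ,
  inJ⁺ d {A , B , C} ¬R (λ (on , _) → neverAbove⇒¬onSide d never on) ¬opp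
  where
  opp≢ : ∀ d → opp d ≢ d
  opp≢ up   ()
  opp≢ down ()

  -- If `C` were empty, `B` would be all of the path and end with both `d` and its opposite.
  ¬R : ¬ C ≡ []
  ¬R refl = opp≢ d (emptyOrEndsWith-last D₀
    (subst (EmptyOrEndsWith (opp d)) (trans (sym (++-identityʳ B)) eq) ends))

  -- Here `B` would be empty, so the whole path would never rise above 0 towards `d`, although it
  -- has points on both sides.
  ¬opp : ¬ InSide (opp d) (A , B , C)
  ¬opp (_ , ends′) with ends-both (opp d) ends ends′
  ... | refl = neverAbove⇒¬onSide d (subst (NeverAbove d) eq never) (onBothSides d above below)

-- The graph of `g`.

-- On τ, the map g is insertion in direction d applied to σ.

data Lift : Step → Triple → Triple → Set where
  peak   : ∀ {τ} → InU τ → Lift up τ τ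
  trough : ∀ {τ} → ¬ InU τ → InV τ → Lift down τ τ
  joined : ∀ {A B C} → InJ (A , B , C) → Lift down (A , B , C) (A , [] , B ++ C)

lift-flat : ∀ {d τ σ} → FlatTriple τ → Lift d τ σ → FlatTriple σ
lift-flat flatτ (peak _)     = flatτ
lift-flat flatτ (trough _ _) = flatτ
lift-flat {τ = _ , B , C} (a , b , c) (joined _) =
  a , mkFlat up [] refl , flat λ d → trans (flat-++ˡ d B C (net≡0 b d)) (net≡0 c d)

lift-total : ∀ {d τ σ} → Lift d τ σ → ∀ s → total s σ ≡ total s τ
lift-total (peak _)     s = refl
lift-total (trough _ _) s = refl
lift-total {τ = A , B , C} (joined _) s = begin
  count s A + 0 + count s (B ++ C)     ≡⟨ cong (_+ count s (B ++ C)) (ℕ.+-identityʳ _) ⟩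
  count s A + count s (B ++ C)         ≡⟨ cong (count s A +_) (count-++ s B C) ⟩
  count s A + (count s B + count s C)  ≡⟨ ℕ.+-assoc (count s A) _ _ ⟨
  count s A + count s B + count s C    ∎
  where open ≡-Reasoning

-- This keeps the two uses of `t` apart: values of `z` lie in U, while a triple to which `t` is
-- applied directly does not.
joined-inU : ∀ {A B C} → FlatTriple (A , B , C) → InJ (A , B , C) → InU (A , [] , B ++ C)
joined-inU {A} {B} {C} (_ , b , _) J =
  proj₁ (BC-above-below A B C (flat⇒balanced up B (net≡0 b up)) J) , inj₁ refl

lift-injective : ∀ {d τ τ′ σ σ′} → FlatTriple τ → FlatTriple τ′ →
                 Lift d τ σ → Lift d τ′ σ′ → σ ≡ σ′ → τ ≡ τ′
lift-injective f f′ (peak _)      (peak _)      refl = refl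
lift-injective f f′ (trough _ _)  (trough _ _)  refl = refl
lift-injective f f′ (trough ¬U _) (joined J)    refl = contradiction (joined-inU f′ J) ¬U
lift-injective f f′ (joined J)    (trough ¬U _) refl = contradiction (joined-inU f J) ¬U
lift-injective f f′ (joined J)    (joined J′)   eq
  with join-injective f f′ J J′ (cong (proj₂ ∘ proj₂) eq)
... | refl , refl = cong (λ A → A , _ , _) (cong proj₁ eq)

lift-functional : ∀ {d d′ τ σ σ′} → Lift d τ σ → Lift d′ τ σ′ → d ≡ d′ × σ ≡ σ′
lift-functional (peak _)     (peak _)      = refl , refl
lift-functional (peak U)     (trough ¬U _) = contradiction U ¬U
lift-functional (peak U)     (joined J)    = contradiction (inj₂ (inj₁ U)) J
lift-functional (trough ¬U _) (peak U)     = contradiction U ¬U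
lift-functional (trough _ _) (trough _ _)  = refl , refl
lift-functional (trough _ V) (joined J)    = contradiction (inj₂ (inj₂ V)) J
lift-functional (joined J)   (peak U)      = contradiction (inj₂ (inj₁ U)) J
lift-functional (joined J)   (trough _ V)  = contradiction (inj₂ (inj₂ V)) J
lift-functional (joined _)   (joined _)    = refl , refl

-- The empty path has no point off the axis, which excludes U and V, and J excludes an empty C by
-- definition.
¬lift-level : ∀ {d A B σ p} → Lift d (A , B , []) σ → ¬ Insertion d σ p
¬lift-level (joined J) _ = J (inj₁ refl)
¬lift-level {d} (peak _) i with proj₁ (insertion⇒inSide i)
... | zero , ℤ.+<+ ()
¬lift-level (trough _ ((zero , ℤ.+<+ ()) , _)) i

-- The graph of g, where (H , X) is given by the parts of H before and after X.

data Graph : Triple → Path × Path → Set where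
  level  : ∀ {A B p} → p ≡ (A , B) → Graph (A , B , []) p
  lifted : ∀ {d τ σ p} → Lift d τ σ → Insertion d σ p → Graph τ p

lifted-side : ∀ {d τ σ p} → FlatTriple τ → Lift d τ σ → Insertion d σ p → 0ℤ ℤ.< net d (proj₁ p)
lifted-side f l = insertion-side (lift-flat f l)

opposite-sides : ∀ P → 0ℤ ℤ.< net up P → ¬ 0ℤ ℤ.< net down P
opposite-sides P pos neg =
  ℤ.<-asym pos (ℤ.neg-cancel-< (subst (0ℤ ℤ.<_) (net-opp up P) neg))

-- The height of the marked point is zero, positive or negative according to the branch, so only
-- triples from the same branch have to be compared.
graph-injective : ∀ {τ τ′ p} → FlatTriple τ → FlatTriple τ′ → Graph τ p → Graph τ′ p → τ ≡ τ′
graph-injective f f′ (level refl) (level refl) = refl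
graph-injective (a , _) f′ (level refl) (lifted {d} l i) =
  contradiction (sym (net≡0 a d)) (ℤ.<⇒≢ (lifted-side f′ l i))
graph-injective f (a′ , _) (lifted {d} l i) (level refl) =
  contradiction (sym (net≡0 a′ d)) (ℤ.<⇒≢ (lifted-side f l i))
graph-injective {p = P , _} f f′ (lifted {up} l i) (lifted {down} l′ i′) =
  contradiction (lifted-side f′ l′ i′) (opposite-sides P (lifted-side f l i))
graph-injective {p = P , _} f f′ (lifted {down} l i) (lifted {up} l′ i′) =
  contradiction (lifted-side f l i) (opposite-sides P (lifted-side f′ l′ i′))
graph-injective f f′ (lifted {up} l i) (lifted {up} l′ i′) =
  lift-injective f f′ l l′ (insertion-injective (lift-flat f l) (lift-flat f′ l′) i i′)
graph-injective f f′ (lifted {down} l i) (lifted {down} l′ i′) =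
  lift-injective f f′ l l′ (insertion-injective (lift-flat f l) (lift-flat f′ l′) i i′)

graph-functional : ∀ {τ p p′} → Graph τ p → Graph τ p′ → p ≡ p′
graph-functional (level refl)  (level refl)  = refl
graph-functional (level refl)  (lifted l i)  = contradiction i (¬lift-level l)
graph-functional (lifted l i)  (level refl)  = contradiction i (¬lift-level l)
graph-functional (lifted l i)  (lifted l′ i′) with lift-functional l l′
... | refl , refl = insertion-functional i i′

graph-total : ∀ {τ P Q} → Graph τ (P , Q) → ∀ s → total s τ ≡ count s (P ++ Q)
graph-total (level {A} {B} refl) s = trans (ℕ.+-identityʳ _) (sym (count-++ s A B))
graph-total (lifted l i)         s = trans (sym (lift-total l s)) (sym (insertion-total i s))

graph-surjective : ∀ P Q → Flat (P ++ Q) → ∃ λ τ → FlatTriple τ × Graph τ (P , Q)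
graph-surjective P Q f with ℤ.<-cmp 0ℤ (net up P)
... | tri≈ _ 0≡P _ = (P , Q , []) ,
  (flatP , flat (λ d → trans (sym (flat-++ˡ d P Q (net≡0 flatP d))) (net≡0 f d)) , mkFlat up [] refl) ,
  level refl
  where
  flatP : Flat P
  flatP = mkFlat up P (sym 0≡P)
... | tri< 0<P _ _ with insertion-exists up P Q 0<P (net≡0 f up)
...   | σ , fσ , i = σ , fσ , lifted (peak (insertion⇒inSide i)) i
graph-surjective P Q f | tri> _ _ P<0
  with insertion-exists down P Q (subst (0ℤ ℤ.<_) (sym (net-opp up P)) (ℤ.neg-mono-< P<0)) (net≡0 f down)
-- If the preimage under `t` also lies in U, then `g` sends it elsewhere by `s`; but it then lies in
-- I, and its preimage under `z` is taken instead.
... | σ , fσ , i with inU? σ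
...   | no ¬U = σ , fσ , lifted (trough ¬U (insertion⇒inSide i)) i
graph-surjective P Q f | tri> _ _ P<0 | (A , B , D) , (a , b , fD) , i | yes (above , ends)
  with insertion⇒inSide i
... | below , ends′ with ends-both down ends ends′ | join-surjective A fD above below
...   | refl | B′ , C′ , refl , b′ , c′ , J = (A , B′ , C′) , (a , b′ , c′) , lifted (joined J) i

-- Bijectivity of `g`.

cutParts : ∀ {n} → D n → Path × Path
cutParts (H , _ , X) = take (toℕ X) H , drop (toℕ X) H

balanced-irrelevant : ∀ {n} P (b b′ : Balanced n P) → b ≡ b′
balanced-irrelevant _ (u , d) (u′ , d′) = cong₂ _,_ (ℕ.≡-irrelevant u u′) (ℕ.≡-irrelevant d d′)

-- Comparing the two parts avoids equations between points of different paths.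
cutParts-injective : ∀ {n} {y y′ : D n} → cutParts y ≡ cutParts y′ → y ≡ y′
cutParts-injective {y = H , b , X} {H′ , b′ , X′} eq with cutAt H X | cutAt H′ X′
... | cut P Q | cut P′ Q′
  with trans (sym (take-meet P Q)) (trans (cong proj₁ eq) (take-meet P′ Q′))
     | trans (sym (drop-meet P Q)) (trans (cong proj₂ eq) (drop-meet P′ Q′))
... | refl | refl = cong (λ b → P ++ Q , b , meet P Q) (balanced-irrelevant (P ++ Q) b b′)

cutParts-meet : ∀ P Q → (take (toℕ (meet P Q)) (P ++ Q) , drop (toℕ (meet P Q)) (P ++ Q)) ≡ (P , Q)
cutParts-meet P Q = cong₂ _,_ (take-meet P Q) (drop-meet P Q)

flatTriple : ∀ {n} (τ : T n) → FlatTriple (proj₁ τ)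
flatTriple ((A , B , C) , _ , _ , _ , _ , a , b , c) =
  flat (λ d → balanced⇒flat d A a) , flat (λ d → balanced⇒flat d B b) , flat (λ d → balanced⇒flat d C c)

graph-g : ∀ {n} (τ : T n) → Graph (proj₁ τ) (cutParts (g τ))
graph-g ((A , B , C) , i , j , k , eq , a , b , c)
  with inR? (A , B , C) | inU? (A , B , C) | inV? (A , B , C)
graph-g ((A , B , _) , i , j , k , refl , a , b , (refl , _)) | yes refl | _ | _ =
  level (cutParts-meet A B)
... | no _  | yes υ | _ =
  lifted (peak υ) (subst (Insertion up _) (sym (cutParts-meet _ _)) (inSide⇒insertion up υ))
... | no _  | no ¬υ | yes ν =
  lifted (trough ¬υ ν) (subst (Insertion down _) (sym (cutParts-meet _ _)) (inSide⇒insertion down ν))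
... | no ¬ρ | no ¬υ | no ¬ν =
  lifted (joined γ)
    (subst (Insertion down _) (sym (cutParts-meet _ _)) (inSide⇒insertion down (below , inj₁ refl)))
  where
  γ : InJ (A , B , C)
  γ = inJ⁺ up {A , B , C} ¬ρ ¬υ ¬ν
  below : HasPointBelow (B ++ C)
  below = proj₂ (BC-above-below A B C b γ)

-- The indices are the numbers of up steps of the three paths, and equality proofs of natural
-- numbers are unique.
T-≡ : ∀ {n} {τ τ′ : T n} → proj₁ τ ≡ proj₁ τ′ → τ ≡ τ′
T-≡ {τ = τ , _ , _ , _ , e , (refl , a) , (refl , b) , (refl , c)}
    {_ , _ , _ , _ , e′ , (refl , a′) , (refl , b′) , (refl , c′)} refl
  rewrite ℕ.≡-irrelevant e e′ | ℕ.≡-irrelevant a a′ | ℕ.≡-irrelevant b b′ | ℕ.≡-irrelevant c c′ = refl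

g-bijective : ∀ n → Bijective _≡_ _≡_ (g {n})
g-bijective n = injective , surjective
  where
  injective : ∀ {τ τ′} → g {n} τ ≡ g τ′ → τ ≡ τ′
  injective {τ} {τ′} eq = T-≡ (graph-injective (flatTriple τ) (flatTriple τ′)
    (subst (Graph _ ∘ cutParts) eq (graph-g τ)) (graph-g τ′))

  surjective : ∀ y → ∃ λ τ → ∀ {τ′} → τ′ ≡ τ → g τ′ ≡ y
  surjective (H , b , X) with cutAt H X
  ... | cut P Q with graph-surjective P Q (flat λ d → balanced⇒flat d (P ++ Q) b)
  -- The graph relates `τ` both to the parts of `g τ` and to the given parts, so these coincide.
  ...   | (A , B , C) , (fA , fB , fC) , γ = τ , λ { refl → cutParts-injective
      (trans (graph-functional (graph-g τ) γ) (sym (cutParts-meet P Q))) }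
    where
    τ : T n
    τ = (A , B , C) , count up A , count up B , count up C , trans (graph-total γ up) (proj₁ b) ,
        flat⇒balanced up A (net≡0 fA up) , flat⇒balanced up B (net≡0 fB up) , flat⇒balanced up C (net≡0 fC up)

-- Opened late, because C is a variable above.

open import Data.Nat.Combinatorics using (_C_)

-- Counting pointed balanced paths.

PathWith : ℕ → ℕ → Set
PathWith u d = Σ Path λ P → count up P ≡ u × count down P ≡ d

pathWith-≡ : ∀ {u d} {p q : PathWith u d} → proj₁ p ≡ proj₁ q → p ≡ q
pathWith-≡ {p = P , u , d} {_ , u′ , d′} refl =
  cong (P ,_) (cong₂ _,_ (ℕ.≡-irrelevant u u′) (ℕ.≡-irrelevant d d′))

Fin-cong : ∀ {m n} → m ≡ n → Fin m ↔ Fin n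
Fin-cong refl = ↔-refl

pathWith-split : ∀ u d → PathWith (ℕ.suc u) (ℕ.suc d) ↔ (PathWith u (ℕ.suc d) ⊎ PathWith (ℕ.suc u) d)
pathWith-split u d = mk↔ₛ′
  (λ { (up   ∷ P , p , q) → inj₁ (P , ℕ.suc-injective p , q)
     ; (down ∷ P , p , q) → inj₂ (P , p , ℕ.suc-injective q) })
  (λ { (inj₁ (P , p , q)) → up ∷ P , cong ℕ.suc p , q
     ; (inj₂ (P , p , q)) → down ∷ P , p , cong ℕ.suc q })
  (λ { (inj₁ _) → cong inj₁ (pathWith-≡ refl) ; (inj₂ _) → cong inj₂ (pathWith-≡ refl) })
  (λ { (up ∷ _ , _) → pathWith-≡ refl ; (down ∷ _ , _) → pathWith-≡ refl })

pathWith-up : ∀ u → PathWith (ℕ.suc u) 0 ↔ PathWith u 0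
pathWith-up u = mk↔ₛ′
  (λ { (up ∷ P , p , q) → P , ℕ.suc-injective p , q ; (down ∷ _ , _ , ()) })
  (λ (P , p , q) → up ∷ P , cong ℕ.suc p , q)
  (λ _ → pathWith-≡ refl)
  (λ { (up ∷ _ , _) → pathWith-≡ refl ; (down ∷ _ , _ , ()) })

pathWith-down : ∀ d → PathWith 0 (ℕ.suc d) ↔ PathWith 0 d
pathWith-down d = mk↔ₛ′
  (λ { (down ∷ P , p , q) → P , p , ℕ.suc-injective q ; (up ∷ _ , () , _) })
  (λ (P , p , q) → down ∷ P , p , cong ℕ.suc q)
  (λ _ → pathWith-≡ refl)
  (λ { (down ∷ _ , _) → pathWith-≡ refl ; (up ∷ _ , () , _) })

pathWith-empty : PathWith 0 0 ↔ ⊤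
pathWith-empty = mk↔ₛ′ _ (λ _ → [] , refl , refl) (λ _ → refl) λ
  { ([]       , _ , _) → pathWith-≡ refl
  ; (up   ∷ _ , () , _)
  ; (down ∷ _ , _ , ()) }

-- Removing the first step gives Pascal's rule; as this unbalances a path, the two step counts are
-- kept independent.
pathWith↔ : ∀ u d → PathWith u d ↔ Fin ((u + d) C u)
pathWith↔ ℕ.zero    ℕ.zero    = ↔-trans pathWith-empty (↔-sym 1↔⊤)
pathWith↔ ℕ.zero    (ℕ.suc d) = ↔-trans (pathWith-down d) (pathWith↔ 0 d)
pathWith↔ (ℕ.suc u) ℕ.zero    =
  ↔-trans (pathWith-up u)
  (↔-trans (pathWith↔ u 0) (Fin-cong (trans (u+0Cu≡1 u) (sym (u+0Cu≡1 (ℕ.suc u))))))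
  where
  u+0Cu≡1 : ∀ u → (u + 0) C u ≡ 1
  u+0Cu≡1 u = trans (cong (_C u) (ℕ.+-identityʳ u)) (nCn≡1 u)
pathWith↔ (ℕ.suc u) (ℕ.suc d) =
  ↔-trans (pathWith-split u d)
  (↔-trans (pathWith↔ u (ℕ.suc d) ⊎-cong pathWith↔ (ℕ.suc u) d)
  (↔-trans (↔-sym +↔⊎) (Fin-cong pascal)))
  where
  pascal : (u + ℕ.suc d) C u + (ℕ.suc u + d) C ℕ.suc u ≡ (ℕ.suc u + ℕ.suc d) C ℕ.suc u
  pascal = trans (cong (λ m → (u + ℕ.suc d) C u + m C ℕ.suc u) (sym (ℕ.+-suc u d)))
                 (nCk+nC[k+1]≡[n+1]C[k+1] (u + ℕ.suc d) u)

BalancedPath : ℕ → Set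
BalancedPath n = Σ Path (Balanced n)

balancedPath↔ : ∀ n → BalancedPath n ↔ Fin ((2 * n) C n)
balancedPath↔ n = ↔-trans (pathWith↔ n n)
  (Fin-cong (cong (λ m → (n + m) C n) (sym (ℕ.+-identityʳ n))))

length-count : ∀ P → length P ≡ count up P + count down P
length-count []         = refl
length-count (up   ∷ P) = cong ℕ.suc (length-count P)
length-count (down ∷ P) = trans (cong ℕ.suc (length-count P)) (sym (ℕ.+-suc _ _))

point↔ : ∀ {n} P → Balanced n P → Point P ↔ Fin (2 * n + 1)
point↔ {n} P (refl , d) = Fin-cong (begin
  ℕ.suc (length P)                ≡⟨ cong ℕ.suc (length-count P) ⟩
  ℕ.suc (n + count down P)        ≡⟨ cong (λ m → ℕ.suc (n + m)) (trans d (sym (ℕ.+-identityʳ n))) ⟩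
  ℕ.suc (2 * n)                   ≡⟨ ℕ.+-comm 1 (2 * n) ⟩
  2 * n + 1                       ∎)
  where open ≡-Reasoning

D↔ : ∀ n → D n ↔ Fin ((2 * n + 1) * ((2 * n) C n))
D↔ n =
  ↔-trans (↔-sym Σ-assoc)
  (↔-trans (Σ-congˡ (λ {(P , b)} → point↔ P b))
  (↔-trans (balancedPath↔ n ×-cong ↔-refl)
  (↔-trans (↔-sym *↔×) (Fin-cong (ℕ.*-comm ((2 * n) C n) (2 * n + 1))))))

-- Counting triples of balanced paths.

∈-∷↔ : ∀ {A : Set} {x : A} {xs} (F : A → Set) →
       (∃ λ y → y ∈ x ∷ xs × F y) ↔ (F x ⊎ ∃ λ y → y ∈ xs × F y)
∈-∷↔ F = mk↔ₛ′
  (λ { (_ , here refl , z) → inj₁ z ; (y , there p , z) → inj₂ (y , p , z) })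
  (λ { (inj₁ z) → _ , here refl , z ; (inj₂ (y , p , z)) → y , there p , z })
  (λ { (inj₁ _) → refl ; (inj₂ _) → refl })
  (λ { (_ , here refl , _) → refl ; (_ , there _ , _) → refl })

-- A membership proof is a position in the list, so repeated entries count with multiplicity.
sum↔ : ∀ {A : Set} (f : A → ℕ) xs → (∃ λ x → x ∈ xs × Fin (f x)) ↔ Fin (sum (map f xs))
sum↔ f []       = mk↔ₛ′ (λ { (_ , () , _) }) (λ ()) (λ ()) (λ { (_ , () , _) })
sum↔ f (x ∷ xs) =
  ↔-trans (∈-∷↔ (Fin ∘ f)) (↔-trans (↔-refl ⊎-cong sum↔ f xs) (↔-sym +↔⊎))

-- Both sides have at most one proof: the list has no repetitions, so each index triple contributes
-- exactly one summand.
∈-triples↔ : ∀ n i j k → (i + j + k ≡ n) ↔ ((i , j , k) ∈ triples n)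
∈-triples↔ n i j k = mk↔ₛ′ to (proj₂ ∘ ∈-filter⁻ sum? {xs = grid})
  (λ _ → unique⇒irrelevant (setoid _) (Decidable⇒UIP.≡-irrelevant (≡-dec ℕ._≟_ (≡-dec ℕ._≟_ ℕ._≟_)))
     (filter⁺ sum? (cartesianProduct⁺ unique (cartesianProduct⁺ unique unique))) _ _)
  (λ _ → ℕ.≡-irrelevant _ _)
  where
  range = upTo (ℕ.suc n)
  grid = cartesianProduct range (cartesianProduct range range)
  unique = upTo⁺ (ℕ.suc n)
  sum? = λ ((i , j , k) : ℕ × ℕ × ℕ) → i + j + k ℕ.≟ n
  to : i + j + k ≡ n → (i , j , k) ∈ triples n
  to refl = ∈-filter⁺ sum?
    (∈-cartesianProduct⁺
      (∈-upTo⁺ (ℕ.s≤s (ℕ.≤-trans (ℕ.m≤m+n i j) (ℕ.m≤m+n (i + j) k))))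
      (∈-cartesianProduct⁺
        (∈-upTo⁺ (ℕ.s≤s (ℕ.≤-trans (ℕ.m≤n+m j i) (ℕ.m≤m+n (i + j) k))))
        (∈-upTo⁺ (ℕ.s≤s (ℕ.m≤n+m k (i + j))))))
    refl

T↔ : ∀ n → T n ↔
  Fin (sum (map (λ (i , j , k) → ((2 * i) C i) * ((2 * j) C j) * ((2 * k) C k)) (triples n)))
T↔ n =
  ↔-trans regroup
  (↔-trans (Σ-congˡ λ {(i , j , k)} → ∈-triples↔ n i j k ×-cong factors i j k)
  (sum↔ _ (triples n)))
  where
  regroup : T n ↔ ∃ λ (i , j , k) → i + j + k ≡ n × (BalancedPath i × BalancedPath j) × BalancedPath k
  regroup = mk↔ₛ′
    (λ ((A , B , C) , i , j , k , e , a , b , c) → (i , j , k) , e , ((A , a) , (B , b)) , (C , c))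
    (λ ((i , j , k) , e , ((A , a) , (B , b)) , (C , c)) → (A , B , C) , i , j , k , e , a , b , c)
    (λ _ → refl) (λ _ → refl)

  factors : ∀ i j k → ((BalancedPath i × BalancedPath j) × BalancedPath k) ↔
                      Fin (((2 * i) C i) * ((2 * j) C j) * ((2 * k) C k))
  factors i j k =
    ↔-trans (↔-trans (balancedPath↔ i ×-cong balancedPath↔ j) (↔-sym *↔×) ×-cong balancedPath↔ k)
            (↔-sym *↔×)

theorem2 : (n : ℕ) → .{{_ : NonZero n}} →
    Bijective _≡_ _≡_ (g {n}) ×
    (2 * n + 1) * ((2 * n) C n) ≡
    sum (map (λ (i , j , k) → ((2 * i) C i) * ((2 * j) C j) * ((2 * k) C k)) (triples n))
theorem2 n = g-bijective n , ↔⇒≡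
  (↔-trans (↔-sym (D↔ n)) (↔-trans (↔-sym (⤖⇒↔ (mk⤖ (g-bijective n)))) (T↔ n)))
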